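{- Let $n\ge3$, $l\in\{2,\dots,n-1\}$ and $k\in\mathbb{N}$ with $k\ge1$ and $k+l-1\le n$. Then $$P_n^{\mathrm{sep}}(A^{(n)}_{l;k})=\frac{|S^{\mathrm{sep}}_{n-l+1}|\,|S^{\mathrm{sep}}_l|}{|S^{\mathrm{sep}}_n|}.$$
   Context: $S_n$ is the set of permutations of $[n]=\{1,\dots,n\}$, written $\sigma=\sigma_1\sigma_2\cdots\sigma_n$. For $l\in\{2,\dots,n-1\}$ and $k\ge1$ with $k+l-1\le n$, $A^{(n)}_{l;k}\subset S_n$ is the set of $\sigma\in S_n$ for which there exists $a$ with $\{k,k+1,\dots,k+l-1\}=\{\sigma_a,\sigma_{a+1},\dots,\sigma_{a+l-1}\}$. A permutation is separable if it can be constructed from the singleton in $S_1$ by iterating direct sums and skew sums; equivalently (a known result), if it avoids both patterns $2413$ and $3142$. Here $\sigma\in S_n$ contains $\tau\in S_m$ as a pattern if there are indices $1\le i_1<\cdots<i_m\le n$ such that for all $1\le j,j'\le m$, $\sigma_{i_j}<\sigma_{i_{j'}}$ if and only if $\tau_j<\tau_{j'}$; otherwise $\sigma$ avoids $\tau$. $S_n^{\mathrm{sep}}$ is the set of separable permutations in $S_n$, and $P_n^{\mathrm{sep}}$ is the uniform probability measure on $S_n^{\mathrm{sep}}$, so $P_n^{\mathrm{sep}}(A)=|A\cap S_n^{\mathrm{sep}}|/|S_n^{\mathrm{sep}}|$ for $A\subset S_n$. -}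

module Defs where

import Data.Integer.Base as ℤ
open import Data.List.Base
  using (List; []; _∷_; [_]; _++_; map; length; take; drop; filter; upTo; applyUpTo;
         cartesianProductWith)
open import Data.List.Membership.Propositional using (_∈_)
open import Data.List.Membership.Propositional.Properties
  using (∈-∃++; ∈-filter⁺; ∈-filter⁻; ∈-cartesianProductWith⁺)
open import Data.List.Properties
  using (length-++; length-map; length-upTo; map-∘; map-cong; map-id; map-applyUpTo;
         ≡-dec; ∷-injective)
open import Data.List.Relation.Binary.BagAndSetEquality using (_∼[_]_; set)
open import Data.List.Relation.Binary.Permutation.Propositional
  using (_↭_; ↭-refl; ↭-sym; ↭-trans; ↭-prep)
open import Data.List.Relation.Binary.Permutation.Propositional.Properties
  using (shift; drop-∷; ∈-resp-↭; ↭-length)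
open import Data.List.Relation.Binary.Subset.Propositional using (_⊆_)
open import Data.List.Relation.Unary.All as All using (All; []; _∷_)
open import Data.List.Relation.Unary.Any using (here; there)
open import Data.List.Relation.Unary.Unique.Propositional using (Unique)
import Data.List.Relation.Unary.Unique.Propositional.Properties as Unique
open import Data.List.Relation.Unary.AllPairs using ([]; _∷_)
open import Data.Nat.Base hiding (_/_)
open import Data.Nat.Properties
open import Data.Product.Base using (∃-syntax; _×_; _,_; proj₁; proj₂)
open import Data.Rational.Base using (ℚ; _/_)
open import Data.Sum.Base using (_⊎_; inj₁; inj₂)
open import Function.Base using (_∘_)
open import Function.Bundles using (_⇔_; mk⇔; Equivalence)
open import Level using (0ℓ)
open import Relation.Binary.PropositionalEquality
  using (_≡_; _≗_; refl; sym; trans; cong; cong₂; subst)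
open import Relation.Nullary using (Dec; yes; no; contradiction)
open import Relation.Nullary.Decidable using (map′; _×-dec_; _⊎-dec_)
open import Relation.Unary using (Pred; Decidable; _∩_)

open import Data.List.Membership.DecPropositional _≟_ using (_∈?_)

private
  variable
    α β σ τ : List ℕ

Word : Set
Word = List ℕ

-- k, k+1, …, k+l-1: the second argument is a length, not an endpoint.
⟦_⨾_⟧ : ℕ → ℕ → Word
⟦ k ⨾ l ⟧ = map (k +_) (upTo l)

-- A permutation of [n] is the word σ₁σ₂⋯σₙ of its values.
S : ℕ → Pred Word 0ℓ
S n σ = σ ↭ ⟦ 1 ⨾ n ⟧

-- σ_a, σ_{a+1}, …, σ_{a+l-1}. Positions count from 1, so only a ≥ 1 is meaningful.
window : ℕ → ℕ → Word → Word
window a l σ = take l (drop (a ∸ 1) σ)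

A : (n l k : ℕ) → Pred Word 0ℓ
A n l k σ =
  S n σ × ∃[ a ] (1 ≤ a × a + l ∸ 1 ≤ n × ⟦ k ⨾ l ⟧ ∼[ set ] window a l σ)

infixr 5 _⊕_ _⊖_

_⊕_ : Word → Word → Word
σ ⊕ τ = σ ++ map (length σ +_) τ

_⊖_ : Word → Word → Word
σ ⊖ τ = map (length τ +_) σ ++ τ

-- Both sums preserve being a permutation, so every separable word σ
-- lies in S (length σ).
data Separable : Word → Set where
  singleton : Separable [ 1 ]
  direct    : Separable σ → Separable τ → Separable (σ ⊕ τ)
  skew      : Separable σ → Separable τ → Separable (σ ⊖ τ)

Sˢᵉᵖ : ℕ → Pred Word 0ℓ
Sˢᵉᵖ n = S n ∩ Separable

-- A duplicate-free enumeration; card does not depend on the choice of it.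
record Finite (P : Pred Word 0ℓ) : Set where
  field
    elements : List Word
    unique   : Unique elements
    ∈⇔       : ∀ {σ} → σ ∈ elements ⇔ P σ

  card : ℕ
  card = length elements

open Finite public using (card)

∩-finite : {P Q : Pred Word 0ℓ} → Decidable P → Finite Q → Finite (P ∩ Q)
∩-finite {P} P? Q-fin = record
  { elements = filter P? Q.elements
  ; unique   = Unique.filter⁺ P? Q.unique
  ; ∈⇔       = mk⇔
      (λ σ∈ → let (σ∈Q , Pσ) = ∈-filter⁻ P? σ∈ in Pσ , Equivalence.to Q.∈⇔ σ∈Q)
      (λ (Pσ , Qσ) → ∈-filter⁺ P? (Equivalence.from Q.∈⇔ Qσ) Pσ)
  }
  where module Q = Finite Q-fin

∩-comm-finite : {P Q : Pred Word 0ℓ} → Finite (P ∩ Q) → Finite (Q ∩ P)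
∩-comm-finite fin = record
  { elements = F.elements
  ; unique   = F.unique
  ; ∈⇔       = mk⇔
      (λ σ∈ → let (p , q) = Equivalence.to F.∈⇔ σ∈ in q , p)
      (λ (q , p) → Equivalence.from F.∈⇔ (p , q))
  }
  where module F = Finite fin

infix 4 _↭?_

_↭?_ : (σ τ : Word) → Dec (σ ↭ τ)
[]      ↭? []      = yes ↭-refl
[]      ↭? (y ∷ τ) = no λ p → contradiction (↭-length p) λ ()
(x ∷ σ) ↭? τ with x ∈? τ
... | no  x∉τ = no λ p → x∉τ (∈-resp-↭ p (here refl))
... | yes x∈τ with τ₁ , τ₂ , refl ← ∈-∃++ x∈τ =
  map′ (λ p → ↭-trans (↭-prep x p) (↭-sym (shift x τ₁ τ₂)))
       (λ p → drop-∷ (↭-trans p (shift x τ₁ τ₂)))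
       (σ ↭? τ₁ ++ τ₂)

words : ℕ → List ℕ → List Word
words zero    xs = [ [] ]
words (suc m) xs = cartesianProductWith _∷_ xs (words m xs)

words-unique : ∀ m {xs} → Unique xs → Unique (words m xs)
words-unique zero    u = [] ∷ []
words-unique (suc m) u =
  Unique.cartesianProductWith⁺ _∷_ ∷-injective u (words-unique m u)

∈-words : ∀ {xs} σ → All (_∈ xs) σ → σ ∈ words (length σ) xs
∈-words []      []         = here refl
∈-words (x ∷ σ) (x∈ ∷ σ∈) = ∈-cartesianProductWith⁺ _∷_ x∈ (∈-words σ σ∈)

⟦⟧-unique : ∀ k l → Unique ⟦ k ⨾ l ⟧
⟦⟧-unique k l = Unique.map⁺ (+-cancelˡ-≡ k _ _) (Unique.upTo⁺ l)

length-⟦⟧ : ∀ k l → length ⟦ k ⨾ l ⟧ ≡ l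
length-⟦⟧ k l = trans (length-map (k +_) (upTo l)) (length-upTo l)

S? : ∀ n → Decidable (S n)
S? n σ = σ ↭? ⟦ 1 ⨾ n ⟧

S-length : ∀ {n} → S n σ → length σ ≡ n
S-length {n = n} σ∈S = trans (↭-length σ∈S) (length-⟦⟧ 1 n)

S-finite : ∀ n → Finite (S n)
S-finite n = record
  { elements = filter (S? n) (words n ⟦ 1 ⨾ n ⟧)
  ; unique   = Unique.filter⁺ (S? n) (words-unique n (⟦⟧-unique 1 n))
  ; ∈⇔       = mk⇔
      (λ σ∈ → proj₂ (∈-filter⁻ (S? n) {xs = words n ⟦ 1 ⨾ n ⟧} σ∈))
      (λ {σ∈S → ∈-filter⁺ (S? n) (∈words σ∈S) σ∈S})
  }
  where
  ∈words : S n σ → σ ∈ words n ⟦ 1 ⨾ n ⟧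
  ∈words {σ} σ∈S = subst (λ m → σ ∈ words m ⟦ 1 ⨾ n ⟧) (S-length σ∈S)
    (∈-words σ (All.tabulate (∈-resp-↭ σ∈S)))

⊆? : (xs ys : Word) → Dec (xs ⊆ ys)
⊆? xs ys = map′ (λ a {x} → All.lookup a) (λ f → All.tabulate (λ {x} → f {x}))
                (All.all? (_∈? ys) xs)

∼set? : (xs ys : Word) → Dec (xs ∼[ set ] ys)
∼set? xs ys = map′ to from (⊆? xs ys ×-dec ⊆? ys xs)
  where
  to : xs ⊆ ys × ys ⊆ xs → xs ∼[ set ] ys
  to (f , g) = mk⇔ f g
  from : xs ∼[ set ] ys → xs ⊆ ys × ys ⊆ xs
  from e = (λ {x} → Equivalence.to (e {x})) , (λ {x} → Equivalence.from (e {x}))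

A? : ∀ n l k → Decidable (A n l k)
A? n l k σ = S? n σ ×-dec
  map′ (λ (a , _ , p) → a , p)
       (λ (a , p@(_ , a+l≤ , _)) → a , bound a a+l≤ , p)
       (anyUpTo? (λ a → (1 ≤? a) ×-dec (a + l ∸ 1 ≤? n) ×-dec
                         ∼set? ⟦ k ⨾ l ⟧ (window a l σ))
                 (suc (suc n)))
  where
  bound : ∀ a → a + l ∸ 1 ≤ n → a < suc (suc n)
  bound a a+l≤ = s≤s (≤-trans (m≤m+n a l) (m∸n≤o⇒m≤n+o (a + l) 1 a+l≤))
    where
    m∸n≤o⇒m≤n+o : ∀ m n {o} → m ∸ n ≤ o → m ≤ n + o
    m∸n≤o⇒m≤n+o m n p = ≤-trans (m≤n+m∸n m n) (+-monoʳ-≤ n p)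

length-⊕ : ∀ σ τ → length (σ ⊕ τ) ≡ length σ + length τ
length-⊕ σ τ = trans (length-++ σ) (cong (length σ +_) (length-map _ τ))

length-⊖ : ∀ σ τ → length (σ ⊖ τ) ≡ length σ + length τ
length-⊖ σ τ = trans (length-++ (map (length τ +_) σ)) (cong (_+ length τ) (length-map _ σ))

Separable⇒length≥1 : Separable σ → 1 ≤ length σ
Separable⇒length≥1 singleton = s≤s z≤n
Separable⇒length≥1 (direct {σ} {τ} p q) rewrite length-⊕ σ τ =
  ≤-trans (Separable⇒length≥1 p) (m≤m+n _ _)
Separable⇒length≥1 (skew {σ} {τ} p q) rewrite length-⊖ σ τ =
  ≤-trans (Separable⇒length≥1 p) (m≤m+n _ _)

private
  take-++-length : ∀ (xs : Word) {ys} → take (length xs) (xs ++ ys) ≡ xs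
  take-++-length []       = refl
  take-++-length (x ∷ xs) = cong (x ∷_) (take-++-length xs)

  drop-++-length : ∀ (xs : Word) {ys} → drop (length xs) (xs ++ ys) ≡ ys
  drop-++-length []       = refl
  drop-++-length (x ∷ xs) = drop-++-length xs

  unshift : ∀ m xs → map (_∸ m) (map (m +_) xs) ≡ xs
  unshift m xs = trans (sym (map-∘ xs)) (trans (map-cong (m+n∸m≡n m) xs) (map-id xs))

  module Decide
    (_∙_ : Word → Word → Word)
    (length-∙ : ∀ α β → length (α ∙ β) ≡ length α + length β)
    (left right : ℕ → Word → Word)
    (left-∙  : ∀ α β → left  (length α) (α ∙ β) ≡ α)
    (right-∙ : ∀ α β → right (length α) (α ∙ β) ≡ β)
    where

    Splits : Word → Set
    Splits σ = ∃[ α ] ∃[ β ] (Separable α × Separable β × α ∙ β ≡ σ)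

    splits? : ∀ m → (∀ σ → length σ ≤ m → Dec (Separable σ)) →
              ∀ σ → length σ ≤ suc m → Dec (Splits σ)
    splits? m rec σ σ≤ = map′
      (λ (i , _ , p) → left i σ , right i σ , p)
      (λ { (α , β , p , q , refl) →
           length α ,
           s≤s (subst (length α ≤_) (sym (length-∙ α β)) (m≤m+n _ _)) ,
           subst Separable (sym (left-∙ α β)) p ,
           subst Separable (sym (right-∙ α β)) q ,
           cong₂ _∙_ (left-∙ α β) (right-∙ α β) })
      (anyUpTo? (λ i → splitsAs? (left i σ) (right i σ)) (suc (length σ)))
      where
      shorter : Separable α → Separable β → α ∙ β ≡ σ → length α ≤ m × length β ≤ m
      shorter {α} {β} p q refl = s≤s⁻¹ (≤-trans α< α+β≤) , s≤s⁻¹ (≤-trans β< α+β≤)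
        where
        α+β≤ : length α + length β ≤ suc m
        α+β≤ = subst (_≤ suc m) (length-∙ α β) σ≤
        α< : suc (length α) ≤ length α + length β
        α< = subst (_≤ length α + length β) (+-comm (length α) 1)
               (+-monoʳ-≤ (length α) (Separable⇒length≥1 q))
        β< : suc (length β) ≤ length α + length β
        β< = +-monoˡ-≤ (length β) (Separable⇒length≥1 p)

      splitsAs? : ∀ α β → Dec (Separable α × Separable β × α ∙ β ≡ σ)
      splitsAs? α β with length α ≤? m | length β ≤? m
      ... | no  α≰ | _      = no λ (p , q , eq) → α≰ (proj₁ (shorter p q eq))
      ... | yes _  | no β≰  = no λ (p , q , eq) → β≰ (proj₂ (shorter p q eq))
      ... | yes α≤ | yes β≤ = rec α α≤ ×-dec rec β β≤ ×-dec ≡-dec _≟_ (α ∙ β) σ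

  ⊖-left-shift : ∀ α β → length (α ⊖ β) ∸ length α ≡ length β
  ⊖-left-shift α β = trans (cong (_∸ length α) (length-⊖ α β)) (m+n∸m≡n (length α) _)

  ⊖-++ : ∀ α β (f : ∀ {X : Set} → ℕ → List X → List X) →
         f (length α) (α ⊖ β) ≡ f (length (map (length β +_) α)) (α ⊖ β)
  ⊖-++ α β f = cong (λ i → f i (α ⊖ β)) (sym (length-map _ α))

  module ⊕-Decide = Decide _⊕_ length-⊕
    take
    (λ i σ → map (_∸ i) (drop i σ))
    (λ α β → take-++-length α)
    (λ α β → trans (cong (map _) (drop-++-length α)) (unshift (length α) β))

  module ⊖-Decide = Decide _⊖_ length-⊖
    (λ i σ → map (_∸ (length σ ∸ i)) (take i σ))
    drop
    (λ α β → trans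
      (cong₂ (λ m → map (_∸ m)) (⊖-left-shift α β)
             (trans (⊖-++ α β take) (take-++-length (map (length β +_) α))))
      (unshift (length β) α))
    (λ α β → trans (⊖-++ α β drop) (drop-++-length (map (length β +_) α)))

  separable?′ : ∀ m σ → length σ ≤ m → Dec (Separable σ)
  separable?′ zero    []  _   = no λ p → contradiction (Separable⇒length≥1 p) λ ()
  separable?′ (suc m) σ  σ≤ = map′ build analyse
    (≡-dec _≟_ [ 1 ] σ
      ⊎-dec ⊕-Decide.splits? m (separable?′ m) σ σ≤
      ⊎-dec ⊖-Decide.splits? m (separable?′ m) σ σ≤)
    where
    Cases : Word → Set
    Cases σ = [ 1 ] ≡ σ ⊎ ⊕-Decide.Splits σ ⊎ ⊖-Decide.Splits σ

    build : Cases σ → Separable σ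
    build (inj₁ refl)                               = singleton
    build (inj₂ (inj₁ (α , β , p , q , refl)))      = direct p q
    build (inj₂ (inj₂ (α , β , p , q , refl)))      = skew p q

    analyse : Separable σ → Cases σ
    analyse singleton    = inj₁ refl
    analyse (direct p q) = inj₂ (inj₁ (_ , _ , p , q , refl))
    analyse (skew p q)   = inj₂ (inj₂ (_ , _ , p , q , refl))

separable? : Decidable Separable
separable? σ = separable?′ (length σ) σ ≤-refl

Sˢᵉᵖ-finite : ∀ n → Finite (Sˢᵉᵖ n)
Sˢᵉᵖ-finite n = ∩-comm-finite (∩-finite separable? (S-finite n))

∣Sˢᵉᵖ_∣ : ℕ → ℕ
∣Sˢᵉᵖ n ∣ = card (Sˢᵉᵖ-finite n)

private
  ⟦⟧-suc : ∀ k l → ⟦ k ⨾ suc l ⟧ ≡ k + 0 ∷ ⟦ suc k ⨾ l ⟧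
  ⟦⟧-suc k l = cong (k + 0 ∷_) (go k l)
    where
    applyUpTo-cong : ∀ {f g : ℕ → ℕ} → f ≗ g → ∀ l → applyUpTo f l ≡ applyUpTo g l
    applyUpTo-cong f≗g zero    = refl
    applyUpTo-cong f≗g (suc l) = cong₂ _∷_ (f≗g 0) (applyUpTo-cong (f≗g ∘ suc) l)
    go : ∀ k l → map (k +_) (applyUpTo suc l) ≡ ⟦ suc k ⨾ l ⟧
    go k l = trans (map-applyUpTo suc (k +_) l)
      (trans (applyUpTo-cong (λ i → +-suc k i) l) (sym (map-applyUpTo (λ i → i) (suc k +_) l)))

identity-separable : ∀ n → Separable ⟦ 1 ⨾ suc n ⟧
identity-separable zero    = singleton
identity-separable (suc n) = subst Separable eq (direct singleton (identity-separable n))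
  where
  eq : [ 1 ] ⊕ ⟦ 1 ⨾ suc n ⟧ ≡ ⟦ 1 ⨾ suc (suc n) ⟧
  eq = trans (cong (1 ∷_) (sym (map-∘ (upTo (suc n))))) (sym (⟦⟧-suc 1 (suc n)))

instance
  ∣Sˢᵉᵖ∣-nonZero : ∀ {n} .{{_ : NonZero n}} → NonZero ∣Sˢᵉᵖ n ∣
  ∣Sˢᵉᵖ∣-nonZero {suc n} = inhabited
    (Equivalence.from (Finite.∈⇔ (Sˢᵉᵖ-finite (suc n))) (↭-refl , identity-separable n))
    where
    inhabited : ∀ {xs : List Word} → σ ∈ xs → NonZero (length xs)
    inhabited (here _)  = _
    inhabited (there _) = _

Pˢᵉᵖ : ∀ n .{{_ : NonZero n}} {X : Pred Word 0ℓ} → Decidable X → ℚ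
Pˢᵉᵖ n X? = ℤ.+ card (∩-finite X? (Sˢᵉᵖ-finite n)) / ∣Sˢᵉᵖ n ∣

{-# OPTIONS --safe #-}

-- Collapsing the block of values {k, …, k+l-1} of a σ ∈ A(n,l,k) to the single
-- letter k gives π ∈ S (n-l+1), and standardising the block gives τ ∈ S l;
-- σ is recovered by inflating the letter k of π by τ. It remains to see that σ
-- is separable iff both π and τ are. For this, separability is relaxed to words
-- with arbitrary distinct letters, where it depends only on the relative order
-- of the letters and passes to nonempty subwords: π and τ are, up to order
-- isomorphism, subwords of σ.

module Submission where

open import Defs
open import Data.Nat.Base using (ℕ; NonZero; _+_; _*_; _∸_; _≤_; _≥_)
open import Data.Rational.Base using (_/_)
open import Relation.Binary.PropositionalEquality using (_≡_)

open import Data.List.Base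
  using (List; []; _∷_; [_]; _++_; map; length; take; drop; filter; concatMap; upTo; applyUpTo;
         cartesianProduct)
open import Data.List.Membership.Propositional using (_∈_)
open import Data.List.Membership.Propositional.Properties
  using (∈-∃++; ∈-map⁺; ∈-map⁻; ∈-++⁺ˡ; ∈-++⁺ʳ; ∈-insert; ∈-length; ∈-concatMap⁻;
         ∈-cartesianProduct⁺; ∈-cartesianProduct⁻)
open import Data.List.Membership.Propositional.Properties.WithK using (unique∧set⇒bag)
open import Data.List.Properties
  using (length-++; length-map; map-++; map-∘; map-cong; map-cong-local; map-id-local;
         map-upTo; take++drop≡id; concatMap-++;
         filter-++; filter-all; filter-none; ∷-injectiveˡ; ∷-injectiveʳ; map-injective)
  renaming (++-identityʳ to ++-[])
open import Data.List.Relation.Binary.BagAndSetEquality using (_∼[_]_; set; ∼bag⇒↭)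
open import Data.List.Relation.Binary.Permutation.Propositional
  using (_↭_; ↭-refl; ↭-sym; ↭-trans; ↭-prep; ↭-reflexive; ↭⇒↭ₛ; module PermutationReasoning)
import Data.List.Relation.Binary.Permutation.Propositional as Perm
open import Data.List.Relation.Binary.Permutation.Propositional.Properties as Perm
  using (shift; shifts; drop-∷; ∈-resp-↭; All-resp-↭; ↭-length; filter-↭; ++⁺ˡ; ++⁺ʳ)
import Data.List.Relation.Binary.Permutation.Setoid.Properties as Permₛ
open import Data.List.Relation.Binary.Sublist.Propositional
  using (_⊆_; []; _∷_; _∷ʳ_; ⊆-refl; from∈; lookup)
import Data.List.Relation.Binary.Sublist.Propositional.Properties as Sublist
open import Data.List.Relation.Unary.All as All using (All; []; _∷_)
import Data.List.Relation.Unary.All.Properties as All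
open import Data.List.Relation.Unary.AllPairs using ([]; _∷_)
open import Data.List.Relation.Unary.Any using (Any; here; there)
open import Data.List.Relation.Unary.Unique.Propositional using (Unique)
import Data.List.Relation.Unary.Unique.Propositional.Properties as Unique
open import Data.Nat.Base using (zero; suc; _<_; _⊓_; _⊔_; z≤n; s≤s; s≤s⁻¹)
open import Data.Nat.Properties
open import Data.Product.Base using (∃-syntax; _×_; _,_; proj₁; proj₂)
open import Data.Sum.Base using (_⊎_; inj₁; inj₂)
open import Function.Base using (_∘_; id)
open import Function.Bundles using (_⇔_; mk⇔; Equivalence)
open import Level using (0ℓ)
open import Relation.Binary.Definitions using (Monotonic₁; tri<; tri≈; tri>)
open import Relation.Binary.PropositionalEquality
  using (refl; sym; trans; cong; cong₂; subst; setoid; module ≡-Reasoning)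
open import Relation.Nullary using (contradiction)
open import Relation.Unary using (Pred; _∩_)

private
  variable
    X Y : Set
    P Q : Pred Word 0ℓ
    α β σ τ π : Word

-- Lists

++-injective : ∀ {xs ys us vs : List X} → length xs ≡ length ys →
               xs ++ us ≡ ys ++ vs → xs ≡ ys × us ≡ vs
++-injective {xs = []}     {[]}     _  e = refl , e
++-injective {xs = x ∷ xs} {y ∷ ys} le e =
  let xs≡ys , us≡vs = ++-injective (suc-injective le) (∷-injectiveʳ e)
  in cong₂ _∷_ (∷-injectiveˡ e) xs≡ys , us≡vs

-- The memberships make both lists nonempty. This lets the first blocks of two equal inflations be
-- compared before their lengths are known to agree.
common-head : ∀ {x y : X} {xs ys us vs} → x ∈ xs → y ∈ ys → xs ++ us ≡ ys ++ vs →
              ∃[ z ] (z ∈ xs × z ∈ ys)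
common-head {xs = z ∷ _} {ys = _ ∷ _} _ _ e = z , here refl , here (∷-injectiveˡ e)

take-length-++ : ∀ (xs : List X) {ys} → take (length xs) (xs ++ ys) ≡ xs
take-length-++ []       = refl
take-length-++ (x ∷ xs) = cong (x ∷_) (take-length-++ xs)

drop-length-++ : ∀ (xs : List X) {ys} → drop (length xs) (xs ++ ys) ≡ ys
drop-length-++ []       = refl
drop-length-++ (x ∷ xs) = drop-length-++ xs

length-cartesianProduct : ∀ (xs : List X) (ys : List Y) →
                          length (cartesianProduct xs ys) ≡ length xs * length ys
length-cartesianProduct []       ys = refl
length-cartesianProduct (x ∷ xs) ys = trans (length-++ (map (x ,_) ys))
  (cong₂ _+_ (length-map (x ,_) ys) (length-cartesianProduct xs ys))

-- Injectivity is asked for on members only: `inflate` is injective on pairs of permutations, not on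
-- all pairs of words.
unique-map-local : ∀ {f : X → Y} {xs} →
                   (∀ {x y} → x ∈ xs → y ∈ xs → f x ≡ f y → x ≡ y) →
                   Unique xs → Unique (map f xs)
unique-map-local inj []           = []
unique-map-local inj (x∉xs ∷ xs!) =
  All.map⁺ (All.tabulate λ y∈xs fx≡fy →
    All.lookup x∉xs y∈xs (inj (here refl) (there y∈xs) fx≡fy))
  ∷ unique-map-local (λ x∈ y∈ → inj (there x∈) (there y∈)) xs!

concatMap-↭ : ∀ (f : X → List Y) {xs ys} → xs ↭ ys → concatMap f xs ↭ concatMap f ys
concatMap-↭ f Perm.refl         = ↭-refl
concatMap-↭ f (Perm.prep x p)   = ++⁺ˡ (f x) (concatMap-↭ f p)
concatMap-↭ f (Perm.swap x y p) =
  ↭-trans (shifts (f x) (f y)) (++⁺ˡ (f y) (++⁺ˡ (f x) (concatMap-↭ f p)))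
concatMap-↭ f (Perm.trans p q)  = ↭-trans (concatMap-↭ f p) (concatMap-↭ f q)

↭-++-cancelˡ : ∀ (xs : List X) {ys zs} → xs ++ ys ↭ xs ++ zs → ys ↭ zs
↭-++-cancelˡ []       p = p
↭-++-cancelˡ (x ∷ xs) p = ↭-++-cancelˡ xs (drop-∷ p)

unique-resp-↭ : ∀ {xs ys : List X} → xs ↭ ys → Unique xs → Unique ys
unique-resp-↭ p = Permₛ.Unique-resp-↭ (setoid _) (↭⇒↭ₛ p)

⊆-++⁻ : ∀ (ys : List X) {xs zs} → xs ⊆ ys ++ zs →
        ∃[ us ] ∃[ vs ] (us ++ vs ≡ xs × us ⊆ ys × vs ⊆ zs)
⊆-++⁻ []       p = [] , _ , refl , [] , p
⊆-++⁻ (y ∷ ys) (.y ∷ʳ p) =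
  let us , vs , eq , p₁ , p₂ = ⊆-++⁻ ys p in us , vs , eq , y ∷ʳ p₁ , p₂
⊆-++⁻ (y ∷ ys) (refl ∷ p) =
  let us , vs , eq , p₁ , p₂ = ⊆-++⁻ ys p in y ∷ us , vs , cong (y ∷_) eq , refl ∷ p₁ , p₂

-- Picking one letter from each block locates a copy of `π` inside an inflation of `π`.
map⊆concatMap : ∀ {f : X → Y} {g : X → List Y} → (∀ x → f x ∈ g x) →
                ∀ xs → map f xs ⊆ concatMap g xs
map⊆concatMap f∈g []       = []
map⊆concatMap f∈g (x ∷ xs) = Sublist.++⁺ (from∈ (f∈g x)) (map⊆concatMap f∈g xs)

-- Duplicate-free lists with the same members are equal as bags, hence rearrangements of each other,
-- hence equally long.
card-cong : (F : Finite P) (G : Finite Q) → (∀ {σ} → P σ ⇔ Q σ) → card F ≡ card G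
card-cong F G P⇔Q = ↭-length (∼bag⇒↭ (unique∧set⇒bag F.unique G.unique (mk⇔
    (from G.∈⇔ ∘ to P⇔Q ∘ to F.∈⇔) (from F.∈⇔ ∘ from P⇔Q ∘ to G.∈⇔))))
  where
  module F = Finite F
  module G = Finite G
  open Equivalence

-- Intervals

⟦⟧-∷ : ∀ k l → ⟦ k ⨾ suc l ⟧ ≡ k ∷ ⟦ suc k ⨾ l ⟧
⟦⟧-∷ k l = cong₂ _∷_ (+-identityʳ k) (begin
  map (k +_) (applyUpTo suc l)  ≡⟨ cong (map (k +_)) (map-upTo suc l) ⟨
  map (k +_) (map suc (upTo l))                ≡⟨ map-∘ (upTo l) ⟨
  map (λ i → k + suc i) (upTo l)               ≡⟨ map-cong (+-suc k) (upTo l) ⟩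
  ⟦ suc k ⨾ l ⟧                                ∎)
  where open ≡-Reasoning

⟦⟧-++ : ∀ k a b → ⟦ k ⨾ a + b ⟧ ≡ ⟦ k ⨾ a ⟧ ++ ⟦ k + a ⨾ b ⟧
⟦⟧-++ k zero    b = cong (λ i → ⟦ i ⨾ b ⟧) (sym (+-identityʳ k))
⟦⟧-++ k (suc a) b = begin
  ⟦ k ⨾ suc (a + b) ⟧                       ≡⟨ ⟦⟧-∷ k (a + b) ⟩
  k ∷ ⟦ suc k ⨾ a + b ⟧                     ≡⟨ cong (k ∷_) (⟦⟧-++ (suc k) a b) ⟩
  k ∷ ⟦ suc k ⨾ a ⟧ ++ ⟦ suc k + a ⨾ b ⟧    ≡⟨ cong₂ _++_ (⟦⟧-∷ k a)
                                                 (cong (λ i → ⟦ i ⨾ b ⟧) (+-suc k a)) ⟨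
  ⟦ k ⨾ suc a ⟧ ++ ⟦ k + suc a ⨾ b ⟧        ∎
  where open ≡-Reasoning

map-+-⟦⟧ : ∀ d k l → map (d +_) ⟦ k ⨾ l ⟧ ≡ ⟦ d + k ⨾ l ⟧
map-+-⟦⟧ d k l = trans (sym (map-∘ (upTo l))) (map-cong (λ i → sym (+-assoc d k i)) (upTo l))

map-∸-⟦⟧ : ∀ d k l → map (_∸ d) ⟦ d + k ⨾ l ⟧ ≡ ⟦ k ⨾ l ⟧
map-∸-⟦⟧ d k l = trans (sym (map-∘ (upTo l)))
  (map-cong (λ i → trans (cong (_∸ d) (+-assoc d k i)) (m+n∸m≡n d (k + i))) (upTo l))

all-⟦⟧ : ∀ k l → All (λ x → k ≤ x × x < k + l) ⟦ k ⨾ l ⟧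
all-⟦⟧ k l = All.map⁺ (All.map (λ i<l → m≤m+n k _ , +-monoʳ-< k i<l) (All.all-upTo l))

Within : ℕ → Word → Set
Within n = All λ x → 1 ≤ x × x ≤ n

S-within : ∀ {n} → S n σ → Within n σ
S-within {n = n} σ∈S = All-resp-↭ (↭-sym σ∈S)
  (All.map (λ (1≤x , x<) → 1≤x , s≤s⁻¹ x<) (all-⟦⟧ 1 n))

-- Separability up to order isomorphism

infix 4 _≺_

_≺_ : Word → Word → Set
α ≺ β = ∀ {x y} → x ∈ α → y ∈ β → x < y

-- Distinctness of the letters is built in through the strictness of `≺`. As with `Separable`, the
-- empty word is excluded.
data OrderSeparable : Word → Set where
  letter  : ∀ x → OrderSeparable [ x ]
  ascend  : OrderSeparable α → OrderSeparable β → α ≺ β → OrderSeparable (α ++ β)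
  descend : OrderSeparable α → OrderSeparable β → β ≺ α → OrderSeparable (α ++ β)

-- A subword of `α ++ β` splits into a subword of each part. If both are nonempty, the same
-- constructor joins them; if one is empty, the other is the whole subword.
⊆-orderSeparable : OrderSeparable σ → τ ⊆ σ → τ ≡ [] ⊎ OrderSeparable τ
⊆-orderSeparable (letter x) (.x ∷ʳ [])  = inj₁ refl
⊆-orderSeparable (letter x) (refl ∷ []) = inj₂ (letter x)
⊆-orderSeparable (ascend {α} p q α≺β) τ⊆
  with us , vs , refl , us⊆ , vs⊆ ← ⊆-++⁻ α τ⊆
  with ⊆-orderSeparable p us⊆ | ⊆-orderSeparable q vs⊆
... | inj₁ refl | q′        = q′
... | inj₂ p′   | inj₁ refl = inj₂ (subst OrderSeparable (sym (++-[] us)) p′)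
... | inj₂ p′   | inj₂ q′   =
  inj₂ (ascend p′ q′ λ x∈ y∈ → α≺β (lookup us⊆ x∈) (lookup vs⊆ y∈))
⊆-orderSeparable (descend {α} p q β≺α) τ⊆
  with us , vs , refl , us⊆ , vs⊆ ← ⊆-++⁻ α τ⊆
  with ⊆-orderSeparable p us⊆ | ⊆-orderSeparable q vs⊆
... | inj₁ refl | q′        = q′
... | inj₂ p′   | inj₁ refl = inj₂ (subst OrderSeparable (sym (++-[] us)) p′)
... | inj₂ p′   | inj₂ q′   =
  inj₂ (descend p′ q′ λ x∈ y∈ → β≺α (lookup vs⊆ x∈) (lookup us⊆ y∈))

≺-map : ∀ {g} → (∀ {x y} → x ∈ α → y ∈ β → x < y → g x < g y) → α ≺ β → map g α ≺ map g β
≺-map g-mono α≺β gx∈ gy∈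
  with _ , x∈ , refl ← ∈-map⁻ _ gx∈ | _ , y∈ , refl ← ∈-map⁻ _ gy∈
  = g-mono x∈ y∈ (α≺β x∈ y∈)

-- Monotonicity is local to the letters of `σ` because `collapse` is strictly increasing only on
-- suitable sets of letters.
map-orderSeparable : ∀ {g} → (∀ {x y} → x ∈ σ → y ∈ σ → x < y → g x < g y) →
                     OrderSeparable σ → OrderSeparable (map g σ)
map-orderSeparable {g = g} g-mono (letter x) = letter (g x)
map-orderSeparable {g = g} g-mono (ascend {α} {β} p q α≺β) =
  subst OrderSeparable (sym (map-++ g α β))
    (ascend (map-orderSeparable (λ x∈ y∈ → g-mono (∈-++⁺ˡ x∈) (∈-++⁺ˡ y∈)) p)
            (map-orderSeparable (λ x∈ y∈ → g-mono (∈-++⁺ʳ α x∈) (∈-++⁺ʳ α y∈)) q)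
            (≺-map (λ x∈ y∈ → g-mono (∈-++⁺ˡ x∈) (∈-++⁺ʳ α y∈)) α≺β))
map-orderSeparable {g = g} g-mono (descend {α} {β} p q β≺α) =
  subst OrderSeparable (sym (map-++ g α β))
    (descend (map-orderSeparable (λ x∈ y∈ → g-mono (∈-++⁺ˡ x∈) (∈-++⁺ˡ y∈)) p)
             (map-orderSeparable (λ x∈ y∈ → g-mono (∈-++⁺ʳ α x∈) (∈-++⁺ʳ α y∈)) q)
             (≺-map (λ x∈ y∈ → g-mono (∈-++⁺ʳ α x∈) (∈-++⁺ˡ y∈)) β≺α))

-- A weakly monotone left inverse `g` is strict on the image of `f`: if `g` identified two image
-- letters, their preimages would be equal, and so would the letters.
map-orderSeparable⁻ : ∀ {f g} → Monotonic₁ _≤_ _≤_ g → (∀ {x} → x ∈ σ → g (f x) ≡ x) →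
                      OrderSeparable (map f σ) → OrderSeparable σ
map-orderSeparable⁻ {σ} {f} {g} g-mono gf≡ p =
  subst OrderSeparable
    (trans (sym (map-∘ σ)) (map-id-local (All.tabulate gf≡)))
    (map-orderSeparable strict p)
  where
  strict : ∀ {x y} → x ∈ map f σ → y ∈ map f σ → x < y → g x < g y
  strict fx∈ fy∈ fx<fy
    with x , x∈ , refl ← ∈-map⁻ f fx∈ | y , y∈ , refl ← ∈-map⁻ f fy∈
    = ≤∧≢⇒< (g-mono (<⇒≤ fx<fy)) λ eq →
        <⇒≢ fx<fy (cong f (trans (sym (gf≡ x∈)) (trans eq (gf≡ y∈))))

within-+ : ∀ {m n} → Within m α → Within n β → Within (m + n) (α ++ map (m +_) β)
within-+ {m = m} {n} α≤ β≤ = All.++⁺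
  (All.map (λ (1≤x , x≤m) → 1≤x , ≤-trans x≤m (m≤m+n m n)) α≤)
  (All.map⁺ (All.map (λ (1≤y , y≤n) → ≤-trans 1≤y (m≤n+m _ m) , +-monoʳ-≤ m y≤n) β≤))

separable-within : Separable σ → Within (length σ) σ
separable-within singleton            = (≤-refl , ≤-refl) ∷ []
separable-within (direct {σ} {τ} p q) =
  subst (λ n → Within n (σ ⊕ τ)) (sym (length-⊕ σ τ))
    (within-+ (separable-within p) (separable-within q))
separable-within (skew {σ} {τ} p q) =
  subst (λ n → Within n (σ ⊖ τ)) (trans (+-comm (length τ) _) (sym (length-⊖ σ τ)))
    -- The range ignores the order of the two parts; swapping them gives a skew sum the shape of a
    -- direct sum.
    (All-resp-↭ (Perm.++-comm τ _) (within-+ (separable-within q) (separable-within p)))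

-- The bound `m` separates the two words: shifted letters exceed it because the letters of `β` are
-- at least 1.
within-≺ : ∀ {m n} → Within m α → Within n β → α ≺ map (m +_) β
within-≺ {m = m} α≤ β≤ x∈ m+y∈ with _ , y∈ , refl ← ∈-map⁻ (m +_) m+y∈ =
  ≤-<-trans (proj₂ (All.lookup α≤ x∈))
    (subst (_< m + _) (+-identityʳ m) (+-monoʳ-< m (proj₁ (All.lookup β≤ y∈))))

separable⇒orderSeparable : Separable σ → OrderSeparable σ
separable⇒orderSeparable singleton    = letter 1
separable⇒orderSeparable (direct p q) = ascend
  (separable⇒orderSeparable p)
  (map-orderSeparable (λ _ _ → +-monoʳ-< _) (separable⇒orderSeparable q))
  (within-≺ (separable-within p) (separable-within q))
separable⇒orderSeparable (skew p q)   = descend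
  (map-orderSeparable (λ _ _ → +-monoʳ-< _) (separable⇒orderSeparable p))
  (separable⇒orderSeparable q)
  (within-≺ (separable-within q) (separable-within p))

-- Standardisation

-- The comparison is inclusive, so that ranks of letters start at 1.
rank : Word → ℕ → ℕ
rank σ x = length (filter (_≤? x) σ)

standardise : Word → Word
standardise σ = map (rank σ) σ

length-standardise : ∀ σ → length (standardise σ) ≡ length σ
length-standardise σ = length-map (rank σ) σ

rank-++ : ∀ α β x → rank (α ++ β) x ≡ rank α x + rank β x
rank-++ α β x = trans (cong length (filter-++ (_≤? x) α β)) (length-++ (filter (_≤? x) α))

rank-all : ∀ {x} → All (_≤ x) σ → rank σ x ≡ length σ
rank-all {x = x} σ≤x = cong length (filter-all (_≤? x) σ≤x)

rank-none : ∀ {x} → All (x <_) σ → rank σ x ≡ 0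
rank-none {x = x} x<σ = cong length (filter-none (_≤? x) (All.map <⇒≱ x<σ))

-- Letters of `β` add nothing to the rank of a letter of `α`, while all of `α` is counted in the
-- rank of a letter of `β`. This is exactly the shift in `⊕`.
standardise-ascend : ∀ α β → α ≺ β → standardise (α ++ β) ≡ standardise α ⊕ standardise β
standardise-ascend α β α≺β = trans (map-++ (rank (α ++ β)) α β) (cong₂ _++_
  (map-cong-local (All.tabulate λ {x} x∈ → trans (rank-++ α β x)
    (trans (cong (rank α x +_) (rank-none (All.tabulate (α≺β x∈)))) (+-identityʳ _))))
  (trans
    (map-cong-local (All.tabulate λ {y} y∈ → trans (rank-++ α β y)
      (cong (_+ rank β y) (trans
        (rank-all (All.tabulate λ x∈ → <⇒≤ (α≺β x∈ y∈)))
        (sym (length-standardise α))))))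
    (map-∘ β)))

standardise-descend : ∀ α β → β ≺ α → standardise (α ++ β) ≡ standardise α ⊖ standardise β
standardise-descend α β β≺α = trans (map-++ (rank (α ++ β)) α β) (cong₂ _++_
  (trans
    (map-cong-local (All.tabulate λ {x} x∈ → trans (rank-++ α β x)
      (trans (cong (rank α x +_) (trans
          (rank-all (All.tabulate λ y∈ → <⇒≤ (β≺α y∈ x∈)))
          (sym (length-standardise β))))
        (+-comm (rank α x) _))))
    (map-∘ α))
  (map-cong-local (All.tabulate λ {y} y∈ → trans (rank-++ α β y)
    (cong (_+ rank β y) (rank-none (All.tabulate (β≺α y∈)))))))

standardise-separable : OrderSeparable σ → Separable (standardise σ)
standardise-separable (letter x) =
  subst (λ i → Separable [ i ]) (sym (rank-all {σ = [ x ]} (≤-refl ∷ []))) singleton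
standardise-separable (ascend {α} {β} p q α≺β) =
  subst Separable (sym (standardise-ascend α β α≺β))
    (direct (standardise-separable p) (standardise-separable q))
standardise-separable (descend {α} {β} p q β≺α) =
  subst Separable (sym (standardise-descend α β β≺α))
    (skew (standardise-separable p) (standardise-separable q))

-- Cut the interval after `x`: the first part is counted in full, the second not at all.
rank-interval : ∀ {n x} → x ≤ n → rank ⟦ 1 ⨾ n ⟧ x ≡ x
rank-interval {n} {x} x≤n = begin
  rank ⟦ 1 ⨾ n ⟧ x                          ≡⟨ cong (λ i → rank ⟦ 1 ⨾ i ⟧ x) (m+[n∸m]≡n x≤n) ⟨
  rank ⟦ 1 ⨾ x + d ⟧ x                      ≡⟨ cong (λ w → rank w x) (⟦⟧-++ 1 x d) ⟩
  rank (⟦ 1 ⨾ x ⟧ ++ ⟦ 1 + x ⨾ d ⟧) x       ≡⟨ rank-++ ⟦ 1 ⨾ x ⟧ ⟦ 1 + x ⨾ d ⟧ x ⟩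
  rank ⟦ 1 ⨾ x ⟧ x + rank ⟦ 1 + x ⨾ d ⟧ x   ≡⟨ cong₂ _+_
                                                 (rank-all (All.map (s≤s⁻¹ ∘ proj₂) (all-⟦⟧ 1 x)))
                                                 (rank-none (All.map proj₁ (all-⟦⟧ (1 + x) d))) ⟩
  length ⟦ 1 ⨾ x ⟧ + 0                      ≡⟨ trans (+-identityʳ _) (length-⟦⟧ 1 x) ⟩
  x                                         ∎
  where
  open ≡-Reasoning
  d = n ∸ x

-- Ranks do not depend on the order of the letters, so they may be computed in the sorted word.
standardise-S : ∀ {n} → S n σ → standardise σ ≡ σ
standardise-S {n = n} σ∈S = map-id-local (All.map
  (λ {x} (_ , x≤n) → trans (↭-length (filter-↭ (_≤? x) σ∈S)) (rank-interval x≤n))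
  (S-within σ∈S))

-- Standardising makes the word separable, and it fixes permutations.
orderSeparable⇒separable : ∀ {n} → S n σ → OrderSeparable σ → Separable σ
orderSeparable⇒separable σ∈S p = subst Separable (standardise-S σ∈S) (standardise-separable p)

-- Inflation

-- The block of values is {k, …, k+m}, that is, l = m + 1.
module Inflation (j m : ℕ) where

  k l : ℕ
  k = suc j
  l = suc m

  -- Replacing one value by `l` values takes `m` additional ones, hence the shift above `k`. The
  -- letters of `τ` start at 1, so adding `j` makes them start at `k`.
  block : Word → ℕ → Word
  block τ x with <-cmp x k
  ... | tri< _ _ _ = [ x ]
  ... | tri≈ _ _ _ = map (j +_) τ
  ... | tri> _ _ _ = [ x + m ]

  inflate : Word → Word → Word
  inflate τ = concatMap (block τ)

  block-< : ∀ τ {x} → x < k → block τ x ≡ [ x ]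
  block-< τ {x} x<k with <-cmp x k
  ... | tri< _ _ _   = refl
  ... | tri≈ x≮k _ _ = contradiction x<k x≮k
  ... | tri> x≮k _ _ = contradiction x<k x≮k

  block-k : ∀ τ → block τ k ≡ map (j +_) τ
  block-k τ with <-cmp k k
  ... | tri< _ k≢k _ = contradiction refl k≢k
  ... | tri≈ _ _ _   = refl
  ... | tri> _ k≢k _ = contradiction refl k≢k

  block-> : ∀ τ {x} → k < x → block τ x ≡ [ x + m ]
  block-> τ {x} k<x with <-cmp x k
  ... | tri< _ _ k≮x = contradiction k<x k≮x
  ... | tri≈ _ _ k≮x = contradiction k<x k≮x
  ... | tri> _ _ _   = refl

  -- The map x (x ≤ k), k (k ≤ x ≤ k+m), x-m (k+m ≤ x), in a visibly monotone form.
  collapse : ℕ → ℕ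
  collapse x = x ⊓ (k ⊔ (x ∸ m))

  collapse-mono : Monotonic₁ _≤_ _≤_ collapse
  collapse-mono x≤y = ⊓-mono-≤ x≤y (⊔-monoʳ-≤ k (∸-monoˡ-≤ m x≤y))

  collapse-< : ∀ {x} → x < k → collapse x ≡ x
  collapse-< {x} x<k = m≤n⇒m⊓n≡m (≤-trans (<⇒≤ x<k) (m≤m⊔n k (x ∸ m)))

  collapse-block : ∀ {x} → k ≤ x → x ≤ j + l → collapse x ≡ k
  collapse-block {x} k≤x x≤j+l = trans
    (cong (x ⊓_) (m≥n⇒m⊔n≡m (m≤n+o⇒m∸n≤o x m (≤-trans x≤j+l
      (≤-reflexive (trans (+-suc j m) (+-comm k m)))))))
    (m≥n⇒m⊓n≡n k≤x)

  collapse-> : ∀ {x} → k < x → collapse (x + m) ≡ x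
  collapse-> {x} k<x = trans
    (cong ((x + m) ⊓_) (trans (cong (k ⊔_) (m+n∸n≡m x m)) (m≤n⇒m⊔n≡n (<⇒≤ k<x))))
    (m≥n⇒m⊓n≡n (m≤m+n x m))

  collapse-shifted : ∀ {t} → 1 ≤ t × t ≤ l → collapse (j + t) ≡ k
  collapse-shifted {t} (1≤t , t≤l) = collapse-block
    (subst (_≤ j + t) (+-comm j 1) (+-monoʳ-≤ j 1≤t)) (+-monoʳ-≤ j t≤l)

  -- The three kinds of block lie in the three ranges of `collapse`. Thus each letter of an
  -- inflation determines the letter of `π` it came from, on which order comparison, separability of
  -- `π` and injectivity all rest.
  ∈-block⇒collapse : ∀ {x y} → Within l τ → y ∈ block τ x → collapse y ≡ x
  ∈-block⇒collapse {x = x} τ≤ y∈ with <-cmp x k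
  ∈-block⇒collapse τ≤ (here refl) | tri< x<k _ _ = collapse-< x<k
  ∈-block⇒collapse τ≤ (here refl) | tri> _ _ k<x = collapse-> k<x
  ∈-block⇒collapse τ≤ y∈          | tri≈ _ refl _
    with _ , t∈ , refl ← ∈-map⁻ (j +_) y∈ = collapse-shifted (All.lookup τ≤ t∈)

  ∈-inflate⇒collapse∈ : ∀ {y} → Within l τ → y ∈ inflate τ π → collapse y ∈ π
  ∈-inflate⇒collapse∈ {τ} τ≤ y∈ = go _ (∈-concatMap⁻ (block τ) y∈)
    where
    go : ∀ π {y} → Any (λ x → y ∈ block τ x) π → collapse y ∈ π
    go (x ∷ π) (here y∈)  = here (∈-block⇒collapse τ≤ y∈)
    go (x ∷ π) (there y∈) = there (go π y∈)

  inflate-++ : ∀ τ α β → inflate τ (α ++ β) ≡ inflate τ α ++ inflate τ β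
  inflate-++ τ = concatMap-++ (block τ)

  inflate-∷ : ∀ τ α β → inflate τ (α ++ k ∷ β) ≡ inflate τ α ++ map (j +_) τ ++ inflate τ β
  inflate-∷ τ α β = trans (inflate-++ τ α (k ∷ β))
    (cong (λ w → inflate τ α ++ w ++ inflate τ β) (block-k τ))

  -- By contraposition, so that weak monotonicity of `collapse` suffices.
  inflate-≺ : Within l τ → α ≺ β → inflate τ α ≺ inflate τ β
  inflate-≺ τ≤ α≺β x∈ y∈ = ≰⇒> λ y≤x →
    <⇒≱ (α≺β (∈-inflate⇒collapse∈ τ≤ x∈) (∈-inflate⇒collapse∈ τ≤ y∈)) (collapse-mono y≤x)

  -- Separability of inflations

  block-orderSeparable : OrderSeparable τ → ∀ x → OrderSeparable (block τ x)
  block-orderSeparable q x with <-cmp x k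
  ... | tri< _ _ _ = letter x
  ... | tri≈ _ _ _ = map-orderSeparable (λ _ _ → +-monoʳ-< j) q
  ... | tri> _ _ _ = letter (x + m)

  -- The decomposition tree of `π` becomes one of the inflation when each leaf is replaced by the
  -- tree of its block.
  inflate-orderSeparable : Within l τ → OrderSeparable π → OrderSeparable τ →
                           OrderSeparable (inflate τ π)
  inflate-orderSeparable {τ} τ≤ (letter x) q =
    subst OrderSeparable (sym (++-[] (block τ x))) (block-orderSeparable q x)
  inflate-orderSeparable {τ} τ≤ (ascend {α} {β} p₁ p₂ α≺β) q =
    subst OrderSeparable (sym (inflate-++ τ α β))
      (ascend (inflate-orderSeparable τ≤ p₁ q) (inflate-orderSeparable τ≤ p₂ q)
              (inflate-≺ τ≤ α≺β))
  inflate-orderSeparable {τ} τ≤ (descend {α} {β} p₁ p₂ β≺α) q =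
    subst OrderSeparable (sym (inflate-++ τ α β))
      (descend (inflate-orderSeparable τ≤ p₁ q) (inflate-orderSeparable τ≤ p₂ q)
               (inflate-≺ τ≤ β≺α))

  -- At an occurrence of `k` the shifted `τ` is a factor of the inflation; subtracting `j` undoes
  -- the shift. Nonemptiness of `τ` excludes the empty-subword alternative.
  inflate-orderSeparableˡ⁻ : 1 ≤ length τ → k ∈ π → OrderSeparable (inflate τ π) →
                             OrderSeparable τ
  inflate-orderSeparableˡ⁻ {t ∷ τ} _ k∈π p with α , β , refl ← ∈-∃++ k∈π
    with ⊆-orderSeparable p (subst (map (j +_) (t ∷ τ) ⊆_) (sym (inflate-∷ (t ∷ τ) α β))
           (Sublist.++⁺ˡ (inflate (t ∷ τ) α) (Sublist.++⁺ʳ _ ⊆-refl)))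
  ... | inj₂ q = map-orderSeparable⁻ (∸-monoˡ-≤ j) (λ _ → m+n∸m≡n j _) q

  block-inhabited : 1 ≤ length τ → ∀ x → ∃[ y ] y ∈ block τ x
  block-inhabited {t ∷ τ} _ x with <-cmp x k
  ... | tri< _ _ _ = _ , here refl
  ... | tri≈ _ _ _ = _ , here refl
  ... | tri> _ _ _ = _ , here refl

  -- One letter chosen from each block forms a subword that `collapse` maps back to `π`.
  inflate-orderSeparableʳ⁻ : Within l τ → 1 ≤ length τ → 1 ≤ length π →
                             OrderSeparable (inflate τ π) → OrderSeparable π
  inflate-orderSeparableʳ⁻ {τ} {x ∷ π} τ≤ τ≢[] _ p
    with ⊆-orderSeparable p
           (map⊆concatMap {g = block τ} (λ y → proj₂ (block-inhabited τ≢[] y)) (x ∷ π))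
  ... | inj₂ q = map-orderSeparable⁻ collapse-mono
    (λ {y} _ → ∈-block⇒collapse τ≤ (proj₂ (block-inhabited τ≢[] y))) q

  -- Injectivity of inflation

  length-block : ∀ τ τ′ x → length τ ≡ length τ′ → length (block τ x) ≡ length (block τ′ x)
  length-block τ τ′ x eq with <-cmp x k
  ... | tri< _ _ _ = refl
  ... | tri≈ _ _ _ = trans (length-map (j +_) τ) (trans eq (sym (length-map (j +_) τ′)))
  ... | tri> _ _ _ = refl

  -- The first blocks share their first letter, and `collapse` sends it to the head of `π` and to
  -- that of `π′`. The heads thus agree, so the blocks are equally long and can be cancelled, even
  -- while `τ` and `τ′` may differ.
  inflate-injectiveʳ : ∀ {τ τ′} → Within l τ → Within l τ′ → 1 ≤ length τ → length τ ≡ length τ′ →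
                       ∀ π π′ → inflate τ π ≡ inflate τ′ π′ → π ≡ π′
  inflate-injectiveʳ {τ} {τ′} τ≤ τ′≤ τ≢[] τ~τ′ = go
    where
    block∋ : ∀ x → ∃[ y ] y ∈ block τ x
    block∋ = block-inhabited τ≢[]
    block′∋ : ∀ x → ∃[ y ] y ∈ block τ′ x
    block′∋ = block-inhabited (subst (1 ≤_) τ~τ′ τ≢[])

    go : ∀ π π′ → inflate τ π ≡ inflate τ′ π′ → π ≡ π′
    go []      []        eq = refl
    go []      (x ∷ π′)  eq with block τ′ x | block′∋ x
    go []      (x ∷ π′)  () | _ ∷ _ | _
    go (x ∷ π) []        eq with block τ x | block∋ x
    go (x ∷ π) []        () | _ ∷ _ | _
    go (x ∷ π) (x′ ∷ π′) eq
      with z , z∈ , z∈′ ← common-head (proj₂ (block∋ x)) (proj₂ (block′∋ x′)) eq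
      with refl ← trans (sym (∈-block⇒collapse {x = x} τ≤ z∈)) (∈-block⇒collapse {x = x′} τ′≤ z∈′)
      = cong (x ∷_) (go π π′ (proj₂ (++-injective (length-block τ τ′ x τ~τ′) eq)))

  -- Equally long blocks are stripped from both sides until `k` is reached, where the blocks are the
  -- shifted `τ` and `τ′`.
  inflate-injectiveˡ : ∀ {τ τ′} → length τ ≡ length τ′ → k ∈ π →
                       inflate τ π ≡ inflate τ′ π → τ ≡ τ′
  inflate-injectiveˡ {x ∷ π} {τ} {τ′} τ~τ′ (there k∈π) eq =
    inflate-injectiveˡ τ~τ′ k∈π (proj₂ (++-injective (length-block τ τ′ x τ~τ′) eq))
  inflate-injectiveˡ {_ ∷ π} {τ} {τ′} τ~τ′ (here refl) eq =
    map-injective (+-cancelˡ-≡ j _ _) (begin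
      map (j +_) τ   ≡⟨ block-k τ ⟨
      block τ k      ≡⟨ proj₁ (++-injective (length-block τ τ′ k τ~τ′) eq) ⟩
      block τ′ k     ≡⟨ block-k τ′ ⟩
      map (j +_) τ′  ∎)
    where open ≡-Reasoning

  -- Inflation as an inverse of collapsing

  Outside : Pred ℕ 0ℓ
  Outside x = x < k ⊎ k + l ≤ x

  -- A letter outside the block never collapses to `k`, so `τ` is never inserted.
  inflate-collapse : ∀ τ → All Outside α → inflate τ (map collapse α) ≡ α
  inflate-collapse τ []          = refl
  inflate-collapse τ (_∷_ {x} x∉ α∉) = cong₂ _++_ (block-collapse x∉) (inflate-collapse τ α∉)
    where
    block-collapse : ∀ {x} → Outside x → block τ (collapse x) ≡ [ x ]
    block-collapse (inj₁ x<k) = trans (cong (block τ) (collapse-< x<k)) (block-< τ x<k)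
    block-collapse {x} (inj₂ k+l≤x) =
      -- Write `x` as `(x ∸ m) + m`, the form that `collapse->` expects.
      subst (λ y → block τ (collapse y) ≡ [ y ]) (m∸n+n≡m (m+n≤o⇒n≤o (suc k) k+m<x))
        (trans (cong (block τ) (collapse-> k<x∸m)) (block-> τ k<x∸m))
      where
      k+m<x : suc k + m ≤ x
      k+m<x = subst (_≤ x) (+-suc k m) k+l≤x
      k<x∸m : k < x ∸ m
      k<x∸m = m+n≤o⇒m≤o∸n (suc k) k+m<x

  inflate-collapse-∷ : ∀ τ α β → All Outside α → All Outside β →
    inflate τ (map collapse α ++ k ∷ map collapse β) ≡ α ++ map (j +_) τ ++ β
  inflate-collapse-∷ τ α β α∉ β∉ = trans (inflate-∷ τ (map collapse α) (map collapse β))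
    (cong₂ (λ u v → u ++ map (j +_) τ ++ v) (inflate-collapse τ α∉) (inflate-collapse τ β∉))

  -- Inflations of permutations and the set `A n l k`

  module Permutations (r : ℕ) where

    -- Here `r` counts the values above the block. In terms of `j`, `l` and `r` neither size
    -- involves truncated subtraction; `N` is n-l+1.
    n N : ℕ
    n = j + (l + r)
    N = j + suc r

    low high : Word
    low  = ⟦ 1 ⨾ j ⟧
    high = ⟦ k + l ⨾ r ⟧

    low-outside : All Outside low
    low-outside = All.map (inj₁ ∘ proj₂) (all-⟦⟧ 1 j)

    high-outside : All Outside high
    high-outside = All.map (inj₂ ∘ proj₁) (all-⟦⟧ (k + l) r)

    interval-n : ⟦ 1 ⨾ n ⟧ ≡ low ++ ⟦ k ⨾ l ⟧ ++ high
    interval-n = trans (⟦⟧-++ 1 j (l + r)) (cong (low ++_) (⟦⟧-++ k l r))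

    collapse-high : map collapse high ≡ ⟦ suc k ⨾ r ⟧
    collapse-high = trans (sym (map-∘ (upTo r))) (map-cong shifted (upTo r))
      where
      shifted : ∀ i → collapse (k + l + i) ≡ suc k + i
      shifted i = trans (cong collapse (begin
        k + l + i        ≡⟨ cong (_+ i) (+-suc k m) ⟩
        suc k + m + i    ≡⟨ +-assoc (suc k) m i ⟩
        suc k + (m + i)  ≡⟨ cong (suc k +_) (+-comm m i) ⟩
        suc k + (i + m)  ≡⟨ +-assoc (suc k) i m ⟨
        suc k + i + m    ∎)) (collapse-> (m≤m+n (suc k) i))
        where open ≡-Reasoning

    interval-N : ⟦ 1 ⨾ N ⟧ ≡ map collapse low ++ k ∷ map collapse high
    interval-N = begin
      ⟦ 1 ⨾ N ⟧                                ≡⟨ ⟦⟧-++ 1 j (suc r) ⟩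
      low ++ ⟦ k ⨾ suc r ⟧                     ≡⟨ cong (low ++_) (⟦⟧-∷ k r) ⟩
      low ++ k ∷ ⟦ suc k ⨾ r ⟧                 ≡⟨ cong₂ (λ u v → u ++ k ∷ v)
                                                    (map-id-local (All.map (collapse-< ∘ proj₂) (all-⟦⟧ 1 j)))
                                                    collapse-high ⟨
      map collapse low ++ k ∷ map collapse high  ∎
      where open ≡-Reasoning

    k∈ : S N π → k ∈ π
    k∈ π∈S = ∈-resp-↭ (↭-sym π∈S)
      (subst (k ∈_) (sym interval-N) (∈-insert (map collapse low)))

    shift-S : S l τ → map (j +_) τ ↭ ⟦ k ⨾ l ⟧
    shift-S τ∈S = ↭-trans (Perm.map⁺ (j +_) τ∈S)
      (↭-reflexive (trans (map-+-⟦⟧ j 1 l) (cong (λ i → ⟦ i ⨾ l ⟧) (+-comm j 1))))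

    -- Rearranging `π` only rearranges the blocks, so `π` may be taken sorted; its inflation is then
    -- `low`, the shifted `τ` and `high` in turn.
    inflate-S : S l τ → S N π → S n (inflate τ π)
    inflate-S {τ} {π} τ∈S π∈S = begin
      inflate τ π                                             ↭⟨ concatMap-↭ (block τ) π∈S ⟩
      inflate τ ⟦ 1 ⨾ N ⟧                                     ≡⟨ cong (inflate τ) interval-N ⟩
      inflate τ (map collapse low ++ k ∷ map collapse high)   ≡⟨ inflate-collapse-∷ τ low high low-outside high-outside ⟩
      low ++ map (j +_) τ ++ high                             ↭⟨ ++⁺ˡ low (++⁺ʳ high (shift-S τ∈S)) ⟩
      low ++ ⟦ k ⨾ l ⟧ ++ high                                ≡⟨ interval-n ⟨
      ⟦ 1 ⨾ n ⟧                                               ∎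
      where open PermutationReasoning

    factor-∈A : S n (α ++ σ ++ β) → σ ↭ ⟦ k ⨾ l ⟧ → A n l k (α ++ σ ++ β)
    factor-∈A {α} {σ} {β} ∈S σ↭ =
      -- Positions count from 1, so the factor after `α` starts at `suc (length α)`.
      ∈S , suc (length α) , s≤s z≤n , α+l≤n ,
      subst (⟦ k ⨾ l ⟧ ∼[ set ]_) (sym window≡σ)
        (mk⇔ (∈-resp-↭ (↭-sym σ↭)) (∈-resp-↭ σ↭))
      where
      length-σ : length σ ≡ l
      length-σ = trans (↭-length σ↭) (length-⟦⟧ k l)
      window≡σ : window (suc (length α)) l (α ++ σ ++ β) ≡ σ
      window≡σ = trans (cong (take l) (drop-length-++ α))
        (subst (λ i → take i (σ ++ β) ≡ σ) length-σ (take-length-++ σ))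
      α+l≤n : length α + l ≤ n
      α+l≤n = begin
        length α + l                     ≡⟨ cong (length α +_) length-σ ⟨
        length α + length σ              ≤⟨ +-monoʳ-≤ (length α) (m≤m+n _ (length β)) ⟩
        length α + (length σ + length β) ≡⟨ trans (length-++ α) (cong (length α +_) (length-++ σ)) ⟨
        length (α ++ σ ++ β)             ≡⟨ S-length ∈S ⟩
        n                                ∎
        where open ≤-Reasoning

    -- A window of a permutation has no repeated letters, which upgrades the set equality in `A` to
    -- a rearrangement.
    ∈A-factor : A n l k σ → ∃[ α ] ∃[ β ] ∃[ γ ] (α ++ β ++ γ ≡ σ × β ↭ ⟦ k ⨾ l ⟧)
    ∈A-factor {σ} (σ∈S , a , _ , _ , ∼σ) =
      take (a ∸ 1) σ , window a l σ , drop l (drop (a ∸ 1) σ) ,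
      trans (cong (take (a ∸ 1) σ ++_) (take++drop≡id l (drop (a ∸ 1) σ))) (take++drop≡id (a ∸ 1) σ) ,
      ↭-sym (∼bag⇒↭ (unique∧set⇒bag (⟦⟧-unique k l)
        (Unique.take⁺ l (Unique.drop⁺ (a ∸ 1) (unique-resp-↭ (↭-sym σ∈S) (⟦⟧-unique 1 n)))) ∼σ))

    inflate-∈A : S l τ → S N π → A n l k (inflate τ π)
    inflate-∈A {τ} τ∈S π∈S with α , β , refl ← ∈-∃++ (k∈ π∈S) =
      subst (A n l k) (sym (inflate-∷ τ α β))
        (factor-∈A {α = inflate τ α} (subst (S n) (inflate-∷ τ α β) (inflate-S τ∈S π∈S)) (shift-S τ∈S))

    ∈A-inflate : A n l k σ → ∃[ τ ] ∃[ π ] (S l τ × S N π × inflate τ π ≡ σ)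
    ∈A-inflate σ∈A@(σ∈S , _) with α , β , γ , refl , β↭ ← ∈A-factor σ∈A =
      map (_∸ j) β , map collapse α ++ k ∷ map collapse γ , τ∈S , π∈S ,
      trans (inflate-collapse-∷ _ α γ (All.++⁻ˡ α αγ-outside) (All.++⁻ʳ α αγ-outside))
            (cong (λ w → α ++ w ++ γ) unshifted)
      where
      τ∈S : S l (map (_∸ j) β)
      τ∈S = ↭-trans (Perm.map⁺ (_∸ j) β↭)
        (↭-reflexive (trans (cong (λ i → map (_∸ j) ⟦ i ⨾ l ⟧) (+-comm 1 j)) (map-∸-⟦⟧ j 1 l)))

      unshifted : map (j +_) (map (_∸ j) β) ≡ β
      unshifted = trans (sym (map-∘ β)) (map-id-local (All.map
        (λ (k≤x , _) → m+[n∸m]≡n (<⇒≤ k≤x)) (All-resp-↭ (↭-sym β↭) (all-⟦⟧ k l))))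

      -- Cancelling the window `β` against the values of the block leaves exactly the values outside
      -- it for `α` and `γ`.
      αγ↭ : α ++ γ ↭ low ++ high
      αγ↭ = ↭-++-cancelˡ β (begin
        β ++ α ++ γ              ↭⟨ shifts β α ⟩
        α ++ β ++ γ              ↭⟨ σ∈S ⟩
        ⟦ 1 ⨾ n ⟧                ≡⟨ interval-n ⟩
        low ++ ⟦ k ⨾ l ⟧ ++ high ↭⟨ shifts low ⟦ k ⨾ l ⟧ ⟩
        ⟦ k ⨾ l ⟧ ++ low ++ high ↭⟨ ++⁺ʳ (low ++ high) β↭ ⟨
        β ++ low ++ high         ∎)
        where open PermutationReasoning

      αγ-outside : All Outside (α ++ γ)
      αγ-outside = All-resp-↭ (↭-sym αγ↭) (All.++⁺ low-outside high-outside)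

      π∈S : S N (map collapse α ++ k ∷ map collapse γ)
      π∈S = begin
        map collapse α ++ k ∷ map collapse γ       ↭⟨ shift k (map collapse α) (map collapse γ) ⟩
        k ∷ map collapse α ++ map collapse γ       ≡⟨ cong (k ∷_) (map-++ collapse α γ) ⟨
        k ∷ map collapse (α ++ γ)                  ↭⟨ ↭-prep k (Perm.map⁺ collapse αγ↭) ⟩
        k ∷ map collapse (low ++ high)             ≡⟨ cong (k ∷_) (map-++ collapse low high) ⟩
        k ∷ map collapse low ++ map collapse high  ↭⟨ shift k (map collapse low) (map collapse high) ⟨
        map collapse low ++ k ∷ map collapse high  ≡⟨ interval-N ⟨
        ⟦ 1 ⨾ N ⟧                                  ∎
        where open PermutationReasoning

    -- Counting the separable members of `A n l k`

    length≥1 : S l τ → 1 ≤ length τ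
    length≥1 τ∈S = subst (1 ≤_) (sym (S-length τ∈S)) (s≤s z≤n)

    inflate-separable : Sˢᵉᵖ N π → Sˢᵉᵖ l τ → (A n l k ∩ Sˢᵉᵖ n) (inflate τ π)
    inflate-separable (π∈S , p) (τ∈S , q) =
      inflate-∈A τ∈S π∈S , inflate-S τ∈S π∈S ,
      orderSeparable⇒separable (inflate-S τ∈S π∈S)
        (inflate-orderSeparable (S-within τ∈S)
          (separable⇒orderSeparable p) (separable⇒orderSeparable q))

    separable-inflate : (A n l k ∩ Sˢᵉᵖ n) σ → ∃[ τ ] ∃[ π ] (Sˢᵉᵖ N π × Sˢᵉᵖ l τ × inflate τ π ≡ σ)
    separable-inflate (σ∈A , _ , p) with τ , π , τ∈S , π∈S , refl ← ∈A-inflate σ∈A =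
      τ , π ,
      (π∈S , orderSeparable⇒separable π∈S (inflate-orderSeparableʳ⁻ (S-within τ∈S) (length≥1 τ∈S)
               (∈-length (k∈ π∈S)) p′)) ,
      (τ∈S , orderSeparable⇒separable τ∈S (inflate-orderSeparableˡ⁻ (length≥1 τ∈S) (k∈ π∈S) p′)) ,
      refl
      where p′ = separable⇒orderSeparable p

    -- First `π` is recovered, with `τ` and `τ′` still possibly distinct; then `τ` is read off at
    -- `k`, which occurs in the permutation `π`.
    inflate-injective : ∀ {π π′ τ τ′} → S N π → S l τ → S l τ′ →
                        inflate τ π ≡ inflate τ′ π′ → π ≡ π′ × τ ≡ τ′
    inflate-injective {π} {π′} {τ} {τ′} π∈S τ∈S τ′∈S eq
      with refl ← inflate-injectiveʳ (S-within τ∈S) (S-within τ′∈S) (length≥1 τ∈S)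
                    (trans (S-length τ∈S) (sym (S-length τ′∈S))) π π′ eq
      = refl , inflate-injectiveˡ (trans (S-length τ∈S) (sym (S-length τ′∈S))) (k∈ π∈S) eq

    -- Enumerating by pairs makes the length a product. Injectivity of inflation gives `unique`, and
    -- the factorisation of separable members gives completeness.
    A∩Sˢᵉᵖ-finite : Finite (A n l k ∩ Sˢᵉᵖ n)
    A∩Sˢᵉᵖ-finite = record
      { elements = map inflate′ pairs
      ; unique   = unique-map-local injective (Unique.cartesianProduct⁺ F.unique G.unique)
      ; ∈⇔       = mk⇔ sound complete
      }
      where
      open Equivalence
      module F = Finite (Sˢᵉᵖ-finite N)
      module G = Finite (Sˢᵉᵖ-finite l)

      pairs : List (Word × Word)
      pairs = cartesianProduct F.elements G.elements

      inflate′ : Word × Word → Word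
      inflate′ (π , τ) = inflate τ π

      ∈-pairs⁻ : ∀ {π τ} → (π , τ) ∈ pairs → Sˢᵉᵖ N π × Sˢᵉᵖ l τ
      ∈-pairs⁻ p∈ = let π∈ , τ∈ = ∈-cartesianProduct⁻ F.elements G.elements p∈
                    in to F.∈⇔ π∈ , to G.∈⇔ τ∈

      injective : ∀ {p q} → p ∈ pairs → q ∈ pairs → inflate′ p ≡ inflate′ q → p ≡ q
      injective p∈ q∈ eq =
        let (π∈S , _) , (τ∈S , _) = ∈-pairs⁻ p∈
            _ , (τ′∈S , _)        = ∈-pairs⁻ q∈
            π≡π′ , τ≡τ′           = inflate-injective π∈S τ∈S τ′∈S eq
        in cong₂ _,_ π≡π′ τ≡τ′

      sound : ∀ {σ} → σ ∈ map inflate′ pairs → (A n l k ∩ Sˢᵉᵖ n) σ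
      sound σ∈ with _ , p∈ , refl ← ∈-map⁻ inflate′ σ∈ =
        let π∈ , τ∈ = ∈-pairs⁻ p∈ in inflate-separable π∈ τ∈

      complete : ∀ {σ} → (A n l k ∩ Sˢᵉᵖ n) σ → σ ∈ map inflate′ pairs
      complete σ∈ with τ , π , π∈ , τ∈ , refl ← separable-inflate σ∈ =
        ∈-map⁺ inflate′ (∈-cartesianProduct⁺ (from F.∈⇔ π∈) (from G.∈⇔ τ∈))

    -- The enumeration is arbitrary because `Pˢᵉᵖ` counts with its own, obtained by filtering.
    card-A∩Sˢᵉᵖ : (F : Finite (A n l k ∩ Sˢᵉᵖ n)) → card F ≡ ∣Sˢᵉᵖ N ∣ * ∣Sˢᵉᵖ l ∣
    card-A∩Sˢᵉᵖ F = begin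
      card F                   ≡⟨ card-cong F A∩Sˢᵉᵖ-finite (mk⇔ id id) ⟩
      card A∩Sˢᵉᵖ-finite       ≡⟨ length-map _ (cartesianProduct F₁ F₂) ⟩
      length (cartesianProduct F₁ F₂)   ≡⟨ length-cartesianProduct F₁ F₂ ⟩
      ∣Sˢᵉᵖ N ∣ * ∣Sˢᵉᵖ l ∣    ∎
      where
      open ≡-Reasoning
      F₁ = Finite.elements (Sˢᵉᵖ-finite N)
      F₂ = Finite.elements (Sˢᵉᵖ-finite l)

-- The probability formula

open import Data.Integer.Base using (+_)

theorem2 : (n l k : ℕ) → .{{_ : NonZero n}} → n ≥ 3 → 2 ≤ l → l ≤ n ∸ 1 → k ≥ 1 → k + l ∸ 1 ≤ n →
    Pˢᵉᵖ n (A? n l k) ≡ + (∣Sˢᵉᵖ n ∸ l + 1 ∣ * ∣Sˢᵉᵖ l ∣) / ∣Sˢᵉᵖ n ∣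
theorem2 n (suc m) (suc j) _ _ _ _ j+l≤n =
  -- Both fractions have the same denominator, so only the numerators need comparing.
  cong (λ i → + i / ∣Sˢᵉᵖ n ∣) (count n≡ N≡ (∩-finite (A? n l (suc j)) (Sˢᵉᵖ-finite n)))
  where
  l r : ℕ
  l = suc m
  -- The largest value of the block is k+l-1, which is `j + l`.
  r = n ∸ (j + l)

  n≡ : j + (l + r) ≡ n
  n≡ = trans (sym (+-assoc j l r)) (m+[n∸m]≡n j+l≤n)

  N≡ : j + suc r ≡ n ∸ l + 1
  N≡ = begin
    j + suc r                ≡⟨ +-suc j r ⟩
    suc (j + r)              ≡⟨ +-comm 1 (j + r) ⟩
    j + r + 1                ≡⟨ cong (_+ 1) (m+n∸m≡n l (j + r)) ⟨
    l + (j + r) ∸ l + 1      ≡⟨ cong (λ i → i ∸ l + 1) (x∙yz≈y∙xz l j r) ⟩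
    j + (l + r) ∸ l + 1      ≡⟨ cong (λ i → i ∸ l + 1) n≡ ⟩
    n ∸ l + 1                ∎
    where
    open ≡-Reasoning
    open import Algebra.Properties.CommutativeSemigroup +-commutativeSemigroup using (x∙yz≈y∙xz)

  -- With `n` and `N` generalised to variables, matching on `refl` turns them into the
  -- subtraction-free sizes of `Permutations`.
  count : ∀ {n N} → j + (l + r) ≡ n → j + suc r ≡ N →
          (F : Finite (A n l (suc j) ∩ Sˢᵉᵖ n)) → card F ≡ ∣Sˢᵉᵖ N ∣ * ∣Sˢᵉᵖ l ∣
  count refl refl = Inflation.Permutations.card-A∩Sˢᵉᵖ j m r
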